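{- $\mathrm{MITL}[\mathsf F_{0,\infty},\mathsf P_{0,\infty}]\subsetneq\mathrm{MITL}[\mathsf F_I,\mathsf P_I]$ in expressive power: every timed language definable in $\mathrm{MITL}[\mathsf F_{0,\infty},\mathsf P_{0,\infty}]$ is definable in $\mathrm{MITL}[\mathsf F_I,\mathsf P_I]$, and there is a timed language definable in $\mathrm{MITL}[\mathsf F_I,\mathsf P_I]$ that is not definable in $\mathrm{MITL}[\mathsf F_{0,\infty},\mathsf P_{0,\infty}]$.
   Context: Timed words: let $\Sigma$ be a finite alphabet. A timed word over $\Sigma$ is a finite nonempty sequence $\rho=(\sigma_1,\tau_1)\cdots(\sigma_n,\tau_n)$ with $\sigma_i\in\Sigma$ and real time stamps $0=\tau_1<\tau_2<\cdots<\tau_n$ (strictly monotonic time). $T\Sigma^*$ is the set of timed words over $\Sigma$. Logics: formulas are $\phi::= a\mid \phi\lor\phi\mid\neg\phi\mid \mathsf F_I\phi\mid \mathsf P_I\phi$ with $a\in\Sigma$. Semantics: $\rho,i\models a$ iff $\sigma_i=a$; Boolean connectives as usual; $\rho,i\models\mathsf F_I\phi$ iff there is $j>i$ with $\tau_j-\tau_i\in I$ and $\rho,j\models\phi$; $\rho,i\models\mathsf P_I\phi$ iff there is $j<i$ with $\tau_i-\tau_j\in I$ and $\rho,j\models\phi$. The language defined by $\phi$ is $\mathcal L(\phi)=\{\rho\in T\Sigma^*\mid\rho,1\models\phi\}$. - $\mathrm{MITL}[\mathsf F_I,\mathsf P_I]$: every $I$ is a non-singular interval (not of the form $[c,c]$)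 with non-negative integer endpoints, open or closed at each end, whose right endpoint may be $\infty$. - $\mathrm{MITL}[\mathsf F_{0,\infty},\mathsf P_{0,\infty}]$: moreover every $I$ is of the form $[0,u\rangle$ (i.e. $[0,u)$ or $[0,u]$) or $\langle l,\infty)$ (i.e. $(l,\infty)$ or $[l,\infty)$). Timed languages over all finite alphabets are considered. -}

module Defs where

open import Data.Fin.Base using (Fin; zero; suc; inject₁) renaming (_<_ to _<ᶠ_)
open import Data.Integer.Base using (+_)
open import Data.Integer.Solver using () renaming (module +-*-Solver to ℤ-Solver)
open import Data.Nat.Base as ℕ using (ℕ; zero; suc)
open import Data.Product.Base using (Σ; ∃; _×_)
open import Data.Rational.Base as ℚ using (ℚ; 0ℚ; _/_; ∣_∣; toℚᵘ)
import Data.Rational.Properties as ℚ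
open import Data.Rational.Solver using () renaming (module +-*-Solver to ℚ-Solver)
open import Data.Rational.Unnormalised.Base as ℚᵘ using (mkℚᵘ; *≡*)
import Data.Rational.Unnormalised.Properties as ℚᵘ
open import Data.Sum.Base using (_⊎_)
open import Data.Unit.Base using (⊤)
open import Function.Bundles using (_↔_; _⇔_)
open import Relation.Binary.PropositionalEquality
  using (_≡_; _≢_; refl; sym; cong; cong₂; subst)
open import Relation.Nullary.Negation.Core using (¬_)

-- Bishop reals: regular Cauchy sequences of rationals, with x ≤ y negating y < x.

1/suc : ℕ → ℚ
1/suc n = + 1 / suc n

record ℝ : Set where
  constructor mkℝ
  field
    seq     : ℕ → ℚ
    regular : ∀ m n → ∣ seq m ℚ.- seq n ∣ ℚ.≤ 1/suc m ℚ.+ 1/suc n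

open ℝ public

private
  half+half : ∀ n → 1/suc (suc (n ℕ.+ n)) ℚ.+ 1/suc (suc (n ℕ.+ n)) ≡ 1/suc n
  half+half n = ℚ.toℚᵘ-injective (begin
    toℚᵘ (1/suc k ℚ.+ 1/suc k)          ≈⟨ ℚ.toℚᵘ-homo-+ (1/suc k) (1/suc k) ⟩
    toℚᵘ (1/suc k) ℚᵘ.+ toℚᵘ (1/suc k)  ≈⟨ ℚᵘ.+-cong (unnormalise k) (unnormalise k) ⟩
    mkℚᵘ (+ 1) k ℚᵘ.+ mkℚᵘ (+ 1) k      ≈⟨ *≡* (identity (+ n)) ⟩
    mkℚᵘ (+ 1) n                        ≈⟨ ℚᵘ.≃-sym (unnormalise n) ⟩
    toℚᵘ (1/suc n)                      ∎)
    where
    open import Relation.Binary.Reasoning.Setoid ℚᵘ.≃-setoid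
    import Data.Integer.Base as ℤ
    k = suc (n ℕ.+ n)

    unnormalise : ∀ j → toℚᵘ (1/suc j) ℚᵘ.≃ mkℚᵘ (+ 1) j
    unnormalise j = ℚ.toℚᵘ-fromℚᵘ (mkℚᵘ (+ 1) j)

    identity : ∀ x → let d = + 2 ℤ.+ (x ℤ.+ x) in
               (+ 1 ℤ.* d ℤ.+ + 1 ℤ.* d) ℤ.* (+ 1 ℤ.+ x) ≡ + 1 ℤ.* (d ℤ.* d)
    identity = solve 1 (λ x → let d = con (+ 2) :+ (x :+ x) in
      (con (+ 1) :* d :+ con (+ 1) :* d) :* (con (+ 1) :+ x) := con (+ 1) :* (d :* d)) refl
      where open ℤ-Solver

  regroup : ∀ a b c d → (a ℚ.- b) ℚ.- (c ℚ.- d) ≡ (a ℚ.- c) ℚ.- (b ℚ.- d)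
  regroup = solve 4 (λ a b c d → (a :- b) :- (c :- d) := (a :- c) :- (b :- d)) refl
    where open ℚ-Solver

  interchange : ∀ p q → (p ℚ.+ q) ℚ.+ (p ℚ.+ q) ≡ (p ℚ.+ p) ℚ.+ (q ℚ.+ q)
  interchange = solve 2 (λ p q → (p :+ q) :+ (p :+ q) := (p :+ p) :+ (q :+ q)) refl
    where open ℚ-Solver

infixl 6 _-_
infix  4 _<_ _≤_ _≃_

-- The indices are doubled so that the difference is again regular.
_-_ : ℝ → ℝ → ℝ
seq     (x - y) n   = seq x (suc (n ℕ.+ n)) ℚ.- seq y (suc (n ℕ.+ n))
regular (x - y) m n = begin
  ∣ (xₘ ℚ.- yₘ) ℚ.- (xₙ ℚ.- yₙ) ∣       ≡⟨ cong ∣_∣ (regroup xₘ yₘ xₙ yₙ) ⟩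
  ∣ (xₘ ℚ.- xₙ) ℚ.- (yₘ ℚ.- yₙ) ∣       ≤⟨ ℚ.∣p-q∣≤∣p∣+∣q∣ (xₘ ℚ.- xₙ) (yₘ ℚ.- yₙ) ⟩
  ∣ xₘ ℚ.- xₙ ∣ ℚ.+ ∣ yₘ ℚ.- yₙ ∣       ≤⟨ ℚ.+-mono-≤ (regular x m′ n′) (regular y m′ n′) ⟩
  (1/suc m′ ℚ.+ 1/suc n′) ℚ.+ (1/suc m′ ℚ.+ 1/suc n′)
                                        ≡⟨ interchange (1/suc m′) (1/suc n′) ⟩
  (1/suc m′ ℚ.+ 1/suc m′) ℚ.+ (1/suc n′ ℚ.+ 1/suc n′)
                                        ≡⟨ cong₂ ℚ._+_ (half+half m) (half+half n) ⟩
  1/suc m ℚ.+ 1/suc n                   ∎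
  where
  open ℚ.≤-Reasoning
  m′ = suc (m ℕ.+ m)
  n′ = suc (n ℕ.+ n)
  xₘ = seq x m′
  yₘ = seq y m′
  xₙ = seq x n′
  yₙ = seq y n′

-- The limit of a regular sequence is within 1/(n+1) of its n-th term.
Positive : ℝ → Set
Positive x = ∃ λ n → 1/suc n ℚ.< seq x n

_<_ _≤_ _≃_ : ℝ → ℝ → Set
x < y = Positive (y - x)
x ≤ y = ¬ (y < x)
x ≃ y = x ≤ y × y ≤ x

fromℚ : ℚ → ℝ
seq     (fromℚ q) _   = q
regular (fromℚ q) m n =
  subst (ℚ._≤ 1/suc m ℚ.+ 1/suc n) (sym (cong ∣_∣ (ℚ.+-inverseʳ q)))
    (ℚ.+-mono-≤ {0ℚ} {1/suc m} {0ℚ} {1/suc n} (0≤1/suc m) (0≤1/suc n))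
  where
  0≤1/suc : ∀ k → 0ℚ ℚ.≤ 1/suc k
  0≤1/suc k = ℚ.nonNegative⁻¹ (1/suc k) {{ℚ.normalize-nonNeg 1 (suc k)}}

fromℕ : ℕ → ℝ
fromℕ n = fromℚ (+ n / 1)

record Alphabet : Set₁ where
  field
    Letter : Set
    size   : ℕ
    finite : Letter ↔ Fin size

open Alphabet public

-- Positions are counted from zero: zero is the first position of the word.
record TimedWord (A : Alphabet) : Set where
  field
    length-1   : ℕ
    letter     : Fin (suc length-1) → Letter A
    time       : Fin (suc length-1) → ℝ
    starts     : time zero ≃ fromℕ 0
    increasing : ∀ (i : Fin length-1) → time (inject₁ i) < time (suc i)

  Position : Set
  Position = Fin (suc length-1)

open TimedWord public

TimedLanguage : Alphabet → Set₁
TimedLanguage A = TimedWord A → Set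

data Bracket : Set where
  open′ closed : Bracket

-- Bounds without a point between them, as in (c,c), describe the empty set.
data Interval : Set where
  bounded   : Bracket → ℕ → ℕ → Bracket → Interval
  unbounded : Bracket → ℕ → Interval

Below : Bracket → ℝ → ℝ → Set
Below open′  x y = x < y
Below closed x y = x ≤ y

infix 4 _∈ᴵ_

_∈ᴵ_ : ℝ → Interval → Set
t ∈ᴵ bounded b l u b′ = Below b (fromℕ l) t × Below b′ t (fromℕ u)
t ∈ᴵ unbounded b l    = Below b (fromℕ l) t

NonSingular : Interval → Set
NonSingular I = ∀ c → I ≢ bounded closed c c closed

data ZeroOrInfinity : Interval → Set where
  from-0 : ∀ u b → ZeroOrInfinity (bounded closed 0 u b)
  to-∞   : ∀ b l → ZeroOrInfinity (unbounded b l)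

infixr 6 _∨′_
infix  7 ¬′_

data Formula (A : Alphabet) : Set where
  atom : Letter A → Formula A
  _∨′_ : Formula A → Formula A → Formula A
  ¬′_  : Formula A → Formula A
  F P  : Interval → Formula A → Formula A

infix 4 _,_⊨_

_,_⊨_ : ∀ {A} (ρ : TimedWord A) → Position ρ → Formula A → Set
ρ , i ⊨ atom a = letter ρ i ≡ a
ρ , i ⊨ φ ∨′ ψ = ρ , i ⊨ φ ⊎ ρ , i ⊨ ψ
ρ , i ⊨ ¬′ φ   = ¬ (ρ , i ⊨ φ)
ρ , i ⊨ F I φ  = ∃ λ j → i <ᶠ j × (time ρ j - time ρ i) ∈ᴵ I × ρ , j ⊨ φ
ρ , i ⊨ P I φ  = ∃ λ j → j <ᶠ i × (time ρ i - time ρ j) ∈ᴵ I × ρ , j ⊨ φ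

𝓛 : ∀ {A} → Formula A → TimedLanguage A
𝓛 φ ρ = ρ , zero ⊨ φ

AllIntervals : ∀ {A} → (Interval → Set) → Formula A → Set
AllIntervals C (atom a) = ⊤
AllIntervals C (φ ∨′ ψ) = AllIntervals C φ × AllIntervals C ψ
AllIntervals C (¬′ φ)   = AllIntervals C φ
AllIntervals C (F I φ)  = C I × AllIntervals C φ
AllIntervals C (P I φ)  = C I × AllIntervals C φ

Logic : Set₁
Logic = ∀ {A} → Formula A → Set

MITL[F-I,P-I] : Logic
MITL[F-I,P-I] = AllIntervals NonSingular

MITL[F-0∞,P-0∞] : Logic
MITL[F-0∞,P-0∞] = AllIntervals (λ I → NonSingular I × ZeroOrInfinity I)

DefinableIn : ∀ {A} → Logic → TimedLanguage A → Set
DefinableIn {A} Λ L = Σ (Formula A) λ φ → Λ φ × (∀ ρ → L ρ ⇔ 𝓛 φ ρ)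

{-# OPTIONS --safe #-}

-- The separating formula F (F_(4,5) a) asks for two events at a distance in (4,5).
-- In a word over a single letter with events 4/3 apart there are none; enlarging one
-- gap far from both ends to 5/3 creates some.  A modality over [0,u⟩ or ⟨l,∞)
-- does not notice: seen from a position far from both ends, an event near the
-- middle meeting an upper bound may be replaced by the immediate neighbour (all gaps
-- lie strictly between 1 and 2), and one meeting a lower bound by an event more than
-- every constant of the formula away.  So, up to the depth of the formula, all
-- positions far enough from the ends of either word satisfy the same subformulas.
module Submission where

open import Data.Bool.Base using (Bool; true; false)
open import Data.Fin.Base using (Fin; zero; suc; toℕ; fromℕ<; inject₁)
open import Data.Fin.Properties using (toℕ-fromℕ<; toℕ-inject₁; toℕ<n)
open import Data.Integer.Base as ℤ using (+_)
import Data.Integer.Properties as ℤ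
open import Data.Integer.Solver using () renaming (module +-*-Solver to ℤ-Solver)
open import Data.Nat.Base using (ℕ; zero; suc; _+_; _*_; _∸_; _⊓_; _⊔_; _<_; _≤_; z≤n; s≤s; ∣_-_∣)
open import Data.Nat.Properties
open import Data.Product.Base using (Σ; ∃; _×_; _,_; proj₁; proj₂)
open import Data.Rational.Base as ℚ using (ℚ; 0ℚ; _/_; toℚᵘ)
import Data.Rational.Properties as ℚ
open import Data.Rational.Solver using () renaming (module +-*-Solver to ℚ-Solver)
open import Data.Rational.Unnormalised.Base as ℚᵘ using (mkℚᵘ; *≡*; *<*)
import Data.Rational.Unnormalised.Properties as ℚᵘ
open import Data.Sum.Base as Sum using (_⊎_; inj₁; inj₂)
open import Data.Unit.Base using (tt)
open import Function.Base using (_∘_; id)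
open import Function.Bundles using (_⇔_; mk⇔; Equivalence)
open import Function.Construct.Identity using (↔-id; ⇔-id)
open import Relation.Binary.Definitions using (tri<; tri≈; tri>)
open import Relation.Binary.PropositionalEquality
  using (_≡_; _≢_; refl; sym; trans; cong; cong₂; subst; subst₂)
open import Relation.Nullary.Decidable using (Dec; yes; no; map′; _×-dec_)
open import Relation.Nullary.Negation.Core using (¬_; contradiction)
open import Defs hiding (_-_; _<_; _≤_)
import Defs as ℝ

open Equivalence using (to; from)

-- Multiples of one third

third : ℕ → ℚ
third m = + m / 3

private
  toℚᵘ-third : ∀ m → toℚᵘ (third m) ℚᵘ.≃ mkℚᵘ (+ m) 2
  toℚᵘ-third m = ℚ.toℚᵘ-fromℚᵘ (mkℚᵘ (+ m) 2)

third-+ : ∀ m n → third (m + n) ≡ third m ℚ.+ third n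
third-+ m n = ℚ.toℚᵘ-injective (begin
  toℚᵘ (third (m + n))                 ≈⟨ toℚᵘ-third (m + n) ⟩
  mkℚᵘ (+ (m + n)) 2                   ≈⟨ *≡* (identity (+ m) (+ n)) ⟩
  mkℚᵘ (+ m) 2 ℚᵘ.+ mkℚᵘ (+ n) 2       ≈⟨ ℚᵘ.+-cong (toℚᵘ-third m) (toℚᵘ-third n) ⟨
  toℚᵘ (third m) ℚᵘ.+ toℚᵘ (third n)   ≈⟨ ℚ.toℚᵘ-homo-+ (third m) (third n) ⟨
  toℚᵘ (third m ℚ.+ third n)           ∎)
  where
  open import Relation.Binary.Reasoning.Setoid ℚᵘ.≃-setoid
  identity : ∀ x y → (x ℤ.+ y) ℤ.* + 9 ≡ (x ℤ.* + 3 ℤ.+ y ℤ.* + 3) ℤ.* + 3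
  identity = solve 2 (λ x y → (x :+ y) :* con (+ 9)
    := (x :* con (+ 3) :+ y :* con (+ 3)) :* con (+ 3)) refl
    where open ℤ-Solver

third-∸ : ∀ {m n} → n ≤ m → third m ℚ.- third n ≡ third (m ∸ n)
third-∸ {m} {n} n≤m = begin
  third m ℚ.- third n                        ≡⟨ cong (λ x → third x ℚ.- third n) (m∸n+n≡m n≤m) ⟨
  third (m ∸ n + n) ℚ.- third n              ≡⟨ cong (ℚ._- third n) (third-+ (m ∸ n) n) ⟩
  third (m ∸ n) ℚ.+ third n ℚ.- third n      ≡⟨ cancel (third (m ∸ n)) (third n) ⟩
  third (m ∸ n)                              ∎
  where
  open Relation.Binary.PropositionalEquality.≡-Reasoning
  cancel : ∀ p q → p ℚ.+ q ℚ.- q ≡ p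
  cancel = solve 2 (λ p q → p :+ q :- q := p) refl
    where open ℚ-Solver

third-mono-< : ∀ {m n} → m < n → third m ℚ.< third n
third-mono-< {m} {n} m<n = ℚ.toℚᵘ-cancel-<
  (ℚᵘ.<-respˡ-≃ (ℚᵘ.≃-sym (toℚᵘ-third m)) (ℚᵘ.<-respʳ-≃ (ℚᵘ.≃-sym (toℚᵘ-third n))
    (*<* (ℤ.*-monoʳ-<-pos (+ 3) (ℤ.+<+ m<n)))))

third-cancel-< : ∀ {m n} → third m ℚ.< third n → m < n
third-cancel-< {m} {n} lt with <-cmp m n
... | tri< m<n _ _  = m<n
... | tri≈ _ refl _ = contradiction lt (ℚ.<-irrefl refl)
... | tri> _ _ n<m  = contradiction (third-mono-< n<m) (ℚ.<-asym lt)

-- Reals given by constant sequences of thirds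

infix 4 _≐_

-- Every term is fixed, not only the limit, so the doubled indices of a difference do no harm and
-- comparing reals becomes comparing rationals.
record _≐_ (x : ℝ) (m : ℕ) : Set where
  constructor constantly
  field
    seq-third : ∀ k → seq x k ≡ third m

open _≐_

fromℚ-third-≐ : ∀ m → fromℚ (third m) ≐ m
fromℚ-third-≐ m = constantly λ _ → refl

fromℕ-≐ : ∀ n → fromℕ n ≐ n * 3
fromℕ-≐ n = constantly λ _ → ℚ.fromℚᵘ-cong {mkℚᵘ (+ n) 0} {mkℚᵘ (+ (n * 3)) 2}
  (*≡* (sym (trans (ℤ.*-identityʳ (+ (n * 3))) (ℤ.pos-* n 3))))

private
  Positive⇒0< : ∀ {q} n → 1/suc n ℚ.< q → 0ℚ ℚ.< q
  Positive⇒0< n lt = ℚ.≤-<-trans (ℚ.nonNegative⁻¹ (1/suc n) {{ℚ.normalize-nonNeg 1 (suc n)}}) lt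

  0<-⇒< : ∀ p q → 0ℚ ℚ.< q ℚ.- p → p ℚ.< q
  0<-⇒< p q lt = subst₂ ℚ._<_ (ℚ.+-identityˡ p) (restore p q) (ℚ.+-monoˡ-< p lt)
    where
    restore : ∀ p q → q ℚ.- p ℚ.+ p ≡ q
    restore = solve 2 (λ p q → q :- p :+ p := q) refl
      where open ℚ-Solver

<-≐ : ∀ {x y m n} → x ≐ m → y ≐ n → x ℝ.< y ⇔ m < n
<-≐ {x} {y} {m} {n} x≐m y≐n = mk⇔ ⇒ ⇐
  where
  ⇒ : x ℝ.< y → m < n
  ⇒ (k , lt) = third-cancel-< (0<-⇒< (third m) (third n)
    (Positive⇒0< k (subst (1/suc k ℚ.<_) (cong₂ ℚ._-_ (seq-third y≐n _) (seq-third x≐m _)) lt)))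

  1/4<1/3 : 1/suc 3 ℚ.< third 1
  1/4<1/3 = ℚ.*<* (ℤ.+<+ (s≤s (s≤s (s≤s (s≤s z≤n)))))

  1/4<third : ∀ {d} → 0 < d → 1/suc 3 ℚ.< third d
  1/4<third {suc zero}    _ = 1/4<1/3
  1/4<third {suc (suc d)} _ = ℚ.<-trans 1/4<1/3 (third-mono-< {1} {suc (suc d)} (s≤s (s≤s z≤n)))

  ⇐ : m < n → x ℝ.< y
  -- Distinct multiples of 1/3 differ by at least 1/3 > 1/4, so the index 3 serves for all of them.
  ⇐ m<n = 3 , subst (1/suc 3 ℚ.<_)
    (sym (trans (cong₂ ℚ._-_ (seq-third y≐n _) (seq-third x≐m _)) (third-∸ (<⇒≤ m<n))))
    (1/4<third (m<n⇒0<n∸m m<n))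

≤-≐ : ∀ {x y m n} → x ≐ m → y ≐ n → x ℝ.≤ y ⇔ m ≤ n
≤-≐ x≐m y≐n = mk⇔
  (λ x≤y → ≮⇒≥ (x≤y ∘ from (<-≐ y≐n x≐m)))
  (λ m≤n → ≤⇒≯ m≤n ∘ to (<-≐ y≐n x≐m))

-- Intervals with time counted in thirds

Belowᴺ : Bracket → ℕ → ℕ → Set
Belowᴺ open′  = _<_
Belowᴺ closed = _≤_

infix 4 _∈ᴺ_

_∈ᴺ_ : ℕ → Interval → Set
m ∈ᴺ bounded b l u b′ = Belowᴺ b (l * 3) m × Belowᴺ b′ m (u * 3)
m ∈ᴺ unbounded b l    = Belowᴺ b (l * 3) m

Below-≐ : ∀ b {x y m n} → x ≐ m → y ≐ n → Below b x y ⇔ Belowᴺ b m n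
Below-≐ open′  = <-≐
Below-≐ closed = ≤-≐

∈-≐ : ∀ I {x m} → x ≐ m → x ∈ᴵ I ⇔ m ∈ᴺ I
∈-≐ (bounded b l u b′) x≐m = mk⇔
  (λ (p , q) → to lower p , to upper q) (λ (p , q) → from lower p , from upper q)
  where
  lower = Below-≐ b (fromℕ-≐ l) x≐m
  upper = Below-≐ b′ x≐m (fromℕ-≐ u)
∈-≐ (unbounded b l) x≐m = Below-≐ b (fromℕ-≐ l) x≐m

-- The symmetric `∣ m - n ∣`, rather than `m ∸ n`, lets one notion of distance serve future and past
-- alike.
∸-≐ : ∀ {x y m n} → x ≐ m → y ≐ n → n ≤ m → x ℝ.- y ≐ ∣ m - n ∣
∸-≐ {m = m} {n} x≐m y≐n n≤m = constantly λ _ →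
  trans (cong₂ ℚ._-_ (seq-third x≐m _) (seq-third y≐n _))
    (trans (third-∸ n≤m) (cong third (sym (trans (∣-∣-comm m n) (m≤n⇒∣m-n∣≡n∸m n≤m)))))

Belowᴺ⇒≤ : ∀ b {m n} → Belowᴺ b m n → m ≤ n
Belowᴺ⇒≤ open′  = <⇒≤
Belowᴺ⇒≤ closed = id

<⇒Belowᴺ : ∀ b {m n} → m < n → Belowᴺ b m n
<⇒Belowᴺ open′  = id
<⇒Belowᴺ closed = <⇒≤

-- Intervals, depth and endpoints of formulas

AllIntervals-map : ∀ {A} {C C′ : Interval → Set} → (∀ {I} → C I → C′ I) →
                   ∀ (φ : Formula A) → AllIntervals C φ → AllIntervals C′ φ
AllIntervals-map f (atom a) _       = tt
AllIntervals-map f (φ ∨′ ψ) (p , q) = AllIntervals-map f φ p , AllIntervals-map f ψ q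
AllIntervals-map f (¬′ φ)   p       = AllIntervals-map f φ p
AllIntervals-map f (F I φ)  (c , p) = f c , AllIntervals-map f φ p
AllIntervals-map f (P I φ)  (c , p) = f c , AllIntervals-map f φ p

depth : ∀ {A} → Formula A → ℕ
depth (atom a) = 0
depth (φ ∨′ ψ) = depth φ ⊔ depth ψ
depth (¬′ φ)   = depth φ
depth (F I φ)  = suc (depth φ)
depth (P I φ)  = suc (depth φ)

-- The lower endpoint of a bounded interval is irrelevant, being 0 in from-0.
endpoint : Interval → ℕ
endpoint (bounded _ _ u _) = u
endpoint (unbounded _ l)   = l

maxEndpoint : ∀ {A} → Formula A → ℕ
maxEndpoint (atom a) = 0
maxEndpoint (φ ∨′ ψ) = maxEndpoint φ ⊔ maxEndpoint ψ
maxEndpoint (¬′ φ)   = maxEndpoint φ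
maxEndpoint (F I φ)  = endpoint I ⊔ maxEndpoint φ
maxEndpoint (P I φ)  = endpoint I ⊔ maxEndpoint φ

Unary : Alphabet
Unary = record { Letter = Fin 1 ; size = 1 ; finite = ↔-id (Fin 1) }

-- Time stamps and distances in the two words

module Words (K n₀ : ℕ) where

  -- Positions M apart are more than K time units apart.
  M C N : ℕ
  M = 3 + K
  C = suc n₀ * M
  N = C + C

  -- For `true` this is the indicator of `C < i`: every event after the long gap is one third late.
  late : Bool → ℕ → ℕ
  late false i = 0
  late true  i = 1 ⊓ (i ∸ C)

  -- Time stamps in thirds: consecutive events are 4/3 apart, but in the word for
  -- true the gap after position C is 5/3.
  thirds : Bool → ℕ → ℕ
  thirds b i = late b i + i * 4

  dist : Bool → ℕ → ℕ → ℕ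
  dist b i j = ∣ thirds b i - thirds b j ∣

  dist-comm : ∀ b i j → dist b i j ≡ dist b j i
  dist-comm b i j = ∣-∣-comm (thirds b i) (thirds b j)

  late-mono : ∀ b {i j} → i ≤ j → late b i ≤ late b j
  late-mono false _   = z≤n
  late-mono true  i≤j = ⊓-monoʳ-≤ 1 (∸-monoˡ-≤ C i≤j)

  late≤1 : ∀ b i → late b i ≤ 1
  late≤1 false i = z≤n
  late≤1 true  i = m⊓n≤m 1 (i ∸ C)

  late-before : ∀ {i} → i ≤ C → late true i ≡ 0
  late-before i≤C = cong (1 ⊓_) (m≤n⇒m∸n≡0 i≤C)

  late-after : ∀ {i} → C < i → late true i ≡ 1
  late-after C<i = m≤n⇒m⊓n≡m (m<n⇒0<n∸m C<i)

  thirds-mono-< : ∀ b {i j} → i < j → thirds b i < thirds b j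
  thirds-mono-< b i<j = +-mono-≤-< (late-mono b (<⇒≤ i<j)) (*-monoˡ-< 4 i<j)

  private
    module Ordered (b : Bool) {i j : ℕ} (i≤j : i ≤ j) where
      open ≤-Reasoning

      thirds-+ : ∀ c → c + i * 4 + ∣ i - j ∣ * 4 ≡ c + j * 4
      thirds-+ c = begin-equality
        c + i * 4 + ∣ i - j ∣ * 4     ≡⟨ +-assoc c (i * 4) _ ⟩
        c + (i * 4 + ∣ i - j ∣ * 4)   ≡⟨ cong (λ k → c + k) (*-distribʳ-+ 4 i ∣ i - j ∣) ⟨
        c + (i + ∣ i - j ∣) * 4       ≡⟨ cong (λ k → c + (i + k) * 4) (m≤n⇒∣m-n∣≡n∸m i≤j) ⟩
        c + (i + (j ∸ i)) * 4         ≡⟨ cong (λ k → c + k * 4) (m+[n∸m]≡n i≤j) ⟩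
        c + j * 4                     ∎

      dist-∸ : dist b i j ≡ thirds b j ∸ thirds b i
      dist-∸ = m≤n⇒∣m-n∣≡n∸m (+-mono-≤ (late-mono b i≤j) (*-monoˡ-≤ 4 i≤j))

      lower : ∣ i - j ∣ * 4 ≤ dist b i j
      lower = subst (_ ≤_) (sym dist-∸) (m+n≤o⇒m≤o∸n _ (begin
        ∣ i - j ∣ * 4 + thirds b i        ≡⟨ +-comm _ (thirds b i) ⟩
        late b i + i * 4 + ∣ i - j ∣ * 4  ≡⟨ thirds-+ (late b i) ⟩
        late b i + j * 4                  ≤⟨ +-monoˡ-≤ (j * 4) (late-mono b i≤j) ⟩
        late b j + j * 4                  ∎))

      upper : dist b i j ≤ suc (∣ i - j ∣ * 4)
      upper = subst (_≤ _) (sym dist-∸) (m≤n+o⇒m∸n≤o (thirds b j) (thirds b i) (begin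
        late b j + j * 4                      ≤⟨ +-monoˡ-≤ (j * 4) (late≤1 b j) ⟩
        suc (j * 4)                           ≤⟨ s≤s (m≤n+m (j * 4) (late b i)) ⟩
        suc (late b i + j * 4)                ≡⟨ cong suc (thirds-+ (late b i)) ⟨
        suc (late b i + i * 4 + ∣ i - j ∣ * 4) ≡⟨ +-suc _ _ ⟨
        late b i + i * 4 + suc (∣ i - j ∣ * 4) ∎))

  dist-lower : ∀ b i j → ∣ i - j ∣ * 4 ≤ dist b i j
  dist-lower b i j with ≤-total i j
  ... | inj₁ i≤j = Ordered.lower b i≤j
  ... | inj₂ j≤i = subst₂ _≤_ (cong (_* 4) (∣-∣-comm j i)) (dist-comm b j i) (Ordered.lower b j≤i)

  -- Only one gap is lengthened, by one third, and two positions enclose it at most once.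
  dist-upper : ∀ b i j → dist b i j ≤ suc (∣ i - j ∣ * 4)
  dist-upper b i j with ≤-total i j
  ... | inj₁ i≤j = Ordered.upper b i≤j
  ... | inj₂ j≤i = subst₂ _≤_ (dist-comm b j i) (cong (λ k → suc (k * 4)) (∣-∣-comm j i)) (Ordered.upper b j≤i)

  dist-apart : ∀ b {i j} → i ≢ j → 3 < dist b i j
  dist-apart b {i} {j} i≢j = ≤-trans (*-monoˡ-≤ 4 (n≢0⇒n>0 (i≢j ∘ ∣m-n∣≡0⇒m≡n))) (dist-lower b i j)

  dist-long : ∀ b i j → M ≤ ∣ i - j ∣ → K * 3 < dist b i j
  dist-long b i j M≤k = begin-strict
    K * 3          ≤⟨ *-monoʳ-≤ K (n≤1+n 3) ⟩
    K * 4          <⟨ m<n+m (K * 4) {12} (s≤s z≤n) ⟩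
    M * 4          ≤⟨ *-monoˡ-≤ 4 M≤k ⟩
    ∣ i - j ∣ * 4  ≤⟨ dist-lower b i j ⟩
    dist b i j     ∎
    where open ≤-Reasoning

  -- Positions far from both ends

  -- `n` bounds the nesting of modalities still to be followed; each of them may use up one block of
  -- `M` positions at either end.
  record Middle (n i : ℕ) : Set where
    constructor _,_
    field
      from-start : n * M ≤ i
      to-end     : i + n * M ≤ N

  middle? : ∀ n i → Dec (Middle n i)
  middle? n i = map′ (λ (lo , hi) → lo , hi) (λ (lo , hi) → lo , hi)
    ((n * M ≤? i) ×-dec (i + n * M ≤? N))

  Middle-antitone : ∀ {m n i} → m ≤ n → Middle n i → Middle m i
  Middle-antitone {i = i} m≤n (lo , hi) =
    ≤-trans (*-monoˡ-≤ M m≤n) lo , ≤-trans (+-monoʳ-≤ i (*-monoˡ-≤ M m≤n)) hi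

  Middle-near : ∀ {n i j} → ∣ i - j ∣ ≤ M → Middle (suc n) i → Middle n j
  Middle-near {n} {i} {j} k≤M (lo , hi) =
    +-cancelˡ-≤ M _ _ (≤-trans lo (≤-trans (m≤∣m-n∣+n i j) (+-monoˡ-≤ j k≤M))) ,
    (begin
      j + n * M                ≤⟨ +-monoˡ-≤ (n * M) (m≤n+∣n-m∣ j i) ⟩
      i + ∣ i - j ∣ + n * M    ≤⟨ +-monoˡ-≤ (n * M) (+-monoʳ-≤ i k≤M) ⟩
      i + M + n * M            ≡⟨ +-assoc i M (n * M) ⟩
      i + (M + n * M)          ≤⟨ hi ⟩
      N                        ∎)
    where open ≤-Reasoning

  -- `C` is `suc n₀` blocks away from each end; the spare block pays for the way from `C` to `i`.
  Middle-C : ∀ {n i} → n ≤ n₀ → ∣ C - i ∣ ≤ M → Middle n i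
  Middle-C {n} {i} n≤n₀ near =
    Middle-antitone {n} {n₀} n≤n₀ (Middle-near {n₀} {C} {i} near (≤-refl , ≤-refl))

  -- The relation maintained between positions of the two words: far inside, all positions are
  -- interchangeable; elsewhere they must coincide.
  Similar : ℕ → ℕ → ℕ → Set
  Similar n i i′ = i ≡ i′ ⊎ (Middle n i × Middle n i′)

  Similar-sym : ∀ {n i j} → Similar n i j → Similar n j i
  Similar-sym = Sum.map sym (λ (m , m′) → m′ , m)

  -- The extra third occurs in both time stamps or in neither, so it cancels.
  dist-sameSide : ∀ b b′ i j → late true i ≡ late true j → dist b i j ≡ dist b′ i j
  dist-sameSide b b′ i j eq = trans (base b) (sym (base b′))
    where
    base : ∀ b → dist b i j ≡ ∣ i * 4 - j * 4 ∣
    base false = refl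
    base true  = trans (cong (λ c → ∣ late true i + i * 4 - c + j * 4 ∣) (sym eq))
                       (∣m+n-m+o∣≡∣n-o∣ (late true i) (i * 4) (j * 4))

  ∣-∣-between : ∀ {i c j} → i ≤ c → c ≤ j → ∣ c - i ∣ ≤ ∣ i - j ∣ × ∣ c - j ∣ ≤ ∣ j - i ∣
  ∣-∣-between {i} {c} {j} i≤c c≤j =
    subst₂ _≤_ (trans (sym (m≤n⇒∣m-n∣≡n∸m i≤c)) (∣-∣-comm i c)) (sym (m≤n⇒∣m-n∣≡n∸m i≤j)) (∸-monoˡ-≤ i c≤j) ,
    subst₂ _≤_ (sym (m≤n⇒∣m-n∣≡n∸m c≤j)) (trans (sym (m≤n⇒∣m-n∣≡n∸m i≤j)) (∣-∣-comm i j)) (∸-monoʳ-≤ j i≤c)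
    where i≤j = ≤-trans i≤c c≤j

  -- If `i` and `j` are less than `M` apart but on opposite sides of the long gap, then `C` lies
  -- between them, hence within `M` of `i`, which would put `i` in the middle.
  dist-rigid : ∀ {n} b b′ i j → n ≤ n₀ → ¬ Middle n i →
               dist b i j ≡ dist b′ i j ⊎ M ≤ ∣ i - j ∣
  dist-rigid {n} b b′ i j n≤n₀ ¬mid with M ≤? ∣ i - j ∣
  ... | yes long = inj₂ long
  ... | no short with i ≤? C | j ≤? C
  ... | yes i≤C | yes j≤C = inj₁ (dist-sameSide b b′ i j (trans (late-before i≤C) (sym (late-before j≤C))))
  ... | no i≰C  | no j≰C  = inj₁ (dist-sameSide b b′ i j (trans (late-after (≰⇒> i≰C)) (sym (late-after (≰⇒> j≰C)))))
  ... | yes i≤C | no j≰C  = contradiction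
    (Middle-C n≤n₀ (≤-trans (proj₁ (∣-∣-between i≤C (≰⇒≥ j≰C))) (≰⇒≥ short))) ¬mid
  ... | no i≰C  | yes j≤C = contradiction
    (Middle-C n≤n₀ (≤-trans (proj₂ (∣-∣-between j≤C (≰⇒≥ i≰C))) (≰⇒≥ short))) ¬mid

  -- What the argument uses of the strict order in either direction, so that future
  -- and past modalities are treated at once.
  record Direction (R : ℕ → ℕ → Set) : Set where
    field
      irrefl  : ∀ {i j} → R i j → i ≢ j
      jump    : ∀ {n i k} → 0 < k → k ≤ M → Middle (suc n) i →
                ∃ λ j → R i j × ∣ i - j ∣ ≡ k
      outside : ∀ {n i i′ j} → Middle (suc n) i → Middle (suc n) i′ → R i j → j ≤ N → ¬ Middle n j →
                R i′ j × M ≤ ∣ i′ - j ∣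

  future : Direction _<_
  future = record
    { irrefl  = <⇒≢
    ; jump    = λ {_} {i} {k} 0<k _ _ → i + k , m<m+n i 0<k , ∣m-m+n∣≡n i k
    ; outside = out
    }
    where
    -- Coming after `i`, the position `j` has `n` blocks before it, so it can only miss the middle
    -- by being too near the end. As `i′` has one block more after it, `j` is more than `M` beyond
    -- `i′`.
    out : ∀ {n i i′ j} → Middle (suc n) i → Middle (suc n) i′ → i < j → j ≤ N → ¬ Middle n j →
          i′ < j × M ≤ ∣ i′ - j ∣
    out {n} {i} {i′} {j} (lo , _) (_ , hi′) i<j _ ¬mid =
      ≤-<-trans (m≤m+n i′ M) i′+M<j ,
      subst (M ≤_) (sym (m≤n⇒∣m-n∣≡n∸m (≤-trans (m≤m+n i′ M) (<⇒≤ i′+M<j))))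
        (m+n≤o⇒m≤o∸n M (subst (_≤ j) (+-comm i′ M) (<⇒≤ i′+M<j)))
      where
      nM≤j : n * M ≤ j
      nM≤j = ≤-trans (m≤n+m (n * M) M) (≤-trans lo (<⇒≤ i<j))
      i′+M<j : i′ + M < j
      i′+M<j = +-cancelʳ-< (n * M) _ _
        (≤-<-trans (subst (_≤ N) (sym (+-assoc i′ M (n * M))) hi′) (≰⇒> (λ hi → ¬mid (nM≤j , hi))))

  past : Direction (λ i j → j < i)
  past = record
    { irrefl  = λ j<i → <⇒≢ j<i ∘ sym
    ; jump    = λ {n} {i} {k} 0<k k≤M (lo , _) →
        -- `Middle (suc n) i` leaves at least `M` positions before `i`, so `i ∸ k` is not truncated.
        let k≤i = ≤-trans k≤M (≤-trans (m≤m+n M (n * M)) lo) in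
        i ∸ k , ∸-monoʳ-< 0<k k≤i ,
        trans (∣-∣-comm i (i ∸ k)) (trans (m≤n⇒∣m-n∣≡n∸m (m∸n≤m i k)) (m∸[m∸n]≡n k≤i))
    ; outside = out
    }
    where
    -- The mirror image: here `j` can only be too near the start.
    out : ∀ {n i i′ j} → Middle (suc n) i → Middle (suc n) i′ → j < i → j ≤ N → ¬ Middle n j →
          j < i′ × M ≤ ∣ i′ - j ∣
    out {n} {i} {i′} {j} (_ , hi) (lo′ , _) j<i _ ¬mid =
      ≤-<-trans (m≤n+m j M) M+j<i′ ,
      subst (M ≤_) (trans (sym (m≤n⇒∣m-n∣≡n∸m (≤-trans (m≤n+m j M) (<⇒≤ M+j<i′)))) (∣-∣-comm j i′))
        (m+n≤o⇒m≤o∸n M (<⇒≤ M+j<i′))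
      where
      hi′ : j + n * M ≤ N
      hi′ = ≤-trans (+-mono-≤ (<⇒≤ j<i) (m≤n+m (n * M) M)) hi
      M+j<i′ : M + j < i′
      M+j<i′ = <-≤-trans (+-monoʳ-< M (≰⇒> (λ lo → ¬mid (lo , hi′)))) lo′

  -- Answering a single modality

  module _ {R : ℕ → ℕ → Set} (dir : Direction R) where
    open Direction dir

    private
      six : ∀ {u} → 3 < u * 3 → 6 ≤ u * 3
      six {suc zero}    3<3 = contradiction 3<3 (<-irrefl refl)
      six {suc (suc u)} _   = *-monoˡ-≤ 3 {2} {2 + u} (s≤s (s≤s z≤n))

      beyond : ∀ {b i j l} b₀ → l ≤ K → M ≤ ∣ i - j ∣ → Belowᴺ b₀ (l * 3) (dist b i j)
      beyond {b} {i} {j} b₀ l≤K long = <⇒Belowᴺ b₀ (≤-<-trans (*-monoˡ-≤ 3 l≤K) (dist-long b i j long))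

      short : ∀ {b i j u} b₀ → u ≤ K → Belowᴺ b₀ (dist b i j) (u * 3) → ¬ M ≤ ∣ i - j ∣
      short {b} {i} {j} b₀ u≤K d≤u long = <⇒≱ (dist-long b i j long) (≤-trans (Belowᴺ⇒≤ b₀ d≤u) (*-monoˡ-≤ 3 u≤K))

      -- One round of an Ehrenfeucht-Fraïssé game: a move to `j` in one word is answered by a move
      -- to `j′` in the other.
      stepMiddle : ∀ {n I} b b′ {i i′ j} → ZeroOrInfinity I → endpoint I ≤ K →
        Middle (suc n) i → Middle (suc n) i′ → j ≤ N → R i j → dist b i j ∈ᴺ I →
        ∃ λ j′ → R i′ j′ × dist b′ i′ j′ ∈ᴺ I × Similar n j j′
      stepMiddle b b′ {i} {i′} {j} (from-0 u b₀) u≤K m m′ j≤N r (_ , d≤u)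
        with j′ , r′ , k≡1 ← jump {k = 1} (s≤s z≤n) (s≤s z≤n) m′
        = j′ , r′ , (z≤n , <⇒Belowᴺ b₀ d′<u) ,
          inj₂ (Middle-near (≰⇒≥ (short {b} {i} {j} b₀ u≤K d≤u)) m ,
                Middle-near (subst (_≤ M) (sym k≡1) (s≤s z≤n)) m′)
        where
        -- The neighbour is at most 5 thirds away, while the integer bound, met by an event at least
        -- 4 thirds away, is at least 6 thirds.
        d′<u : dist b′ i′ j′ < u * 3
        d′<u = <-≤-trans
          (s≤s (subst (λ k → dist b′ i′ j′ ≤ suc (k * 4)) k≡1 (dist-upper b′ i′ j′)))
          (six {u} (<-≤-trans (dist-apart b (irrefl r)) (Belowᴺ⇒≤ b₀ d≤u)))
      stepMiddle {n} b b′ {i} {i′} {j} (to-∞ b₀ l) l≤K m m′ j≤N r _ with middle? n j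
      ... | yes mⱼ =
        -- A jump by `M` passes `l` and costs `j′` only one block.
        let (j′ , r′ , k≡M) = jump {k = M} (s≤s z≤n) ≤-refl m′ in
        j′ , r′ , beyond {b′} {i′} {j′} b₀ l≤K (≤-reflexive (sym k≡M)) ,
        inj₂ (mⱼ , Middle-near (≤-reflexive k≡M) m′)
      -- Too near an end to be exchanged, `j` is kept; seen from `i′` it is still in the right
      -- direction and beyond every endpoint.
      ... | no ¬mⱼ =
        let (r′ , long) = outside m m′ r j≤N ¬mⱼ in
        j , r′ , beyond {b′} {i′} {j} b₀ l≤K long , inj₁ refl

    step : ∀ {n I} b b′ {i i′ j} → suc n ≤ n₀ → ZeroOrInfinity I → endpoint I ≤ K →
      Similar (suc n) i i′ → j ≤ N → R i j → dist b i j ∈ᴺ I →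
      ∃ λ j′ → R i′ j′ × dist b′ i′ j′ ∈ᴺ I × Similar n j j′
    step b b′ n<n₀ z e (inj₂ (m , m′)) j≤N r d = stepMiddle b b′ z e m m′ j≤N r d
    step {n} {I} b b′ {i} {_} {j} n<n₀ z e (inj₁ refl) j≤N r d with middle? (suc n) i
    -- Even from a common position `j` cannot simply be kept: the long gap may lie in between and
    -- change the distance.
    ... | yes m = stepMiddle b b′ z e m m j≤N r d
    ... | no ¬m = j , r , same z e d (dist-rigid b b′ i j n<n₀ ¬m) , inj₁ refl
      where
      same : ∀ {I} → ZeroOrInfinity I → endpoint I ≤ K → dist b i j ∈ᴺ I →
             dist b i j ≡ dist b′ i j ⊎ M ≤ ∣ i - j ∣ → dist b′ i j ∈ᴺ I
      same {I} _ _ d (inj₁ eq)               = subst (_∈ᴺ I) eq d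
      same (from-0 u b₀) u≤K (_ , d) (inj₂ long) = contradiction long (short {b} {i} {j} b₀ u≤K d)
      same (to-∞ b₀ l)   l≤K _ (inj₂ long)       = beyond {b′} {i} {j} b₀ l≤K long

  -- The timed words and the invariance of formulas

  word : Bool → TimedWord Unary
  length-1   (word b)   = N
  letter     (word b) _ = zero
  time       (word b) i = fromℚ (third (thirds b (toℕ i)))
  -- Splitting on the Boolean lets `late` at 0 compute to 0.
  starts     (word false) = from (≤-≐ (fromℚ-third-≐ 0) (fromℕ-≐ 0)) z≤n ,
                             from (≤-≐ (fromℕ-≐ 0) (fromℚ-third-≐ 0)) z≤n
  starts     (word true)  = from (≤-≐ (fromℚ-third-≐ 0) (fromℕ-≐ 0)) z≤n ,
                             from (≤-≐ (fromℕ-≐ 0) (fromℚ-third-≐ 0)) z≤n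
  increasing (word b) i = from
    (<-≐ (fromℚ-third-≐ (thirds b (toℕ (inject₁ i)))) (fromℚ-third-≐ (thirds b (suc (toℕ i)))))
    (thirds-mono-< b (s≤s (≤-reflexive (toℕ-inject₁ i))))

  time-≐ : ∀ b (i : Position (word b)) → time (word b) i ≐ thirds b (toℕ i)
  time-≐ b i = fromℚ-third-≐ (thirds b (toℕ i))

  elapsed : ∀ b I (i j : Position (word b)) → toℕ i < toℕ j →
            (time (word b) j ℝ.- time (word b) i) ∈ᴵ I ⇔ dist b (toℕ j) (toℕ i) ∈ᴺ I
  elapsed b I i j i<j = ∈-≐ I (∸-≐ (time-≐ b j) (time-≐ b i) (<⇒≤ (thirds-mono-< b i<j)))

  toPosition : ∀ {j} → j ≤ N → ∃ λ (p : Fin (suc N)) → toℕ p ≡ j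
  toPosition j≤N = fromℕ< (s≤s j≤N) , toℕ-fromℕ< (s≤s j≤N)

  -- `step` answers with a natural number; this makes it a position of the word.
  Similar-≤N : ∀ {n i j} → i ≤ N → Similar n i j → j ≤ N
  Similar-≤N i≤N (inj₁ refl)          = i≤N
  Similar-≤N _   (inj₂ (_ , (_ , hi))) = ≤-trans (m≤m+n _ _) hi

  position≤N : (i : Fin (suc N)) → toℕ i ≤ N
  position≤N i with s≤s i≤N ← toℕ<n i = i≤N

  answer : ∀ {R} → Direction R → ∀ {n I} b b′ (i i′ j : Fin (suc N)) →
    suc n ≤ n₀ → ZeroOrInfinity I → endpoint I ≤ K →
    Similar (suc n) (toℕ i) (toℕ i′) → R (toℕ i) (toℕ j) → dist b (toℕ i) (toℕ j) ∈ᴺ I →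
    ∃ λ (j′ : Fin (suc N)) → R (toℕ i′) (toℕ j′) × dist b′ (toℕ i′) (toℕ j′) ∈ᴺ I ×
      Similar n (toℕ j) (toℕ j′)
  answer dir b b′ i i′ j n<n₀ z e s r d
    with j₀ , r′ , d′ , s′ ← step dir b b′ n<n₀ z e s (position≤N j) r d
    with j′ , refl ← toPosition (Similar-≤N (position≤N j) s′)
    = j′ , r′ , d′ , s′

  -- Induction on the formula. As `b` and `b′` are arbitrary and `Similar` is symmetric, negation
  -- uses the implication backwards; `n` is kept apart from the depth because a disjunct may be
  -- shallower.
  invariant : ∀ (φ : Formula Unary) {n} b b′ {i i′ : Fin (suc N)} →
    MITL[F-0∞,P-0∞] φ → depth φ ≤ n → n ≤ n₀ → maxEndpoint φ ≤ K → Similar n (toℕ i) (toℕ i′) →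
    word b , i ⊨ φ → word b′ , i′ ⊨ φ
  invariant (atom zero) b b′ _ _ _ _ _ _ = refl
  invariant (φ ∨′ ψ) b b′ (p , q) d n≤ k s = Sum.map
    (invariant φ b b′ p (m⊔n≤o⇒m≤o (depth φ) (depth ψ) d) n≤ (m⊔n≤o⇒m≤o (maxEndpoint φ) (maxEndpoint ψ) k) s)
    (invariant ψ b b′ q (m⊔n≤o⇒n≤o (depth φ) (depth ψ) d) n≤ (m⊔n≤o⇒n≤o (maxEndpoint φ) (maxEndpoint ψ) k) s)
  invariant (¬′ φ) b b′ p d n≤ k s ¬φ = ¬φ ∘ invariant φ b′ b p d n≤ k (Similar-sym s)
  invariant (F I φ) b b′ {i} {i′} ((_ , z) , p) (s≤s d) n≤ k s (j , i<j , t , ⊨φ) =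
    let (j′ , r , t′ , s′) = answer future b b′ i i′ j n≤ z (m⊔n≤o⇒m≤o (endpoint I) (maxEndpoint φ) k) s i<j
          -- `elapsed` puts the later position first, `answer` the current one.
          (subst (_∈ᴺ I) (dist-comm b (toℕ j) (toℕ i)) (to (elapsed b I i j i<j) t))
    in j′ , r , from (elapsed b′ I i′ j′ r) (subst (_∈ᴺ I) (dist-comm b′ (toℕ i′) (toℕ j′)) t′) ,
       invariant φ b b′ p d (<⇒≤ n≤) (m⊔n≤o⇒n≤o (endpoint I) (maxEndpoint φ) k) s′ ⊨φ
  invariant (P I φ) b b′ {i} {i′} ((_ , z) , p) (s≤s d) n≤ k s (j , j<i , t , ⊨φ) =
    let (j′ , r , t′ , s′) = answer past b b′ i i′ j n≤ z (m⊔n≤o⇒m≤o (endpoint I) (maxEndpoint φ) k) s j<i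
          (to (elapsed b I j i j<i) t)
    in j′ , r , from (elapsed b′ I j′ i′ r) t′ ,
       invariant φ b b′ p d (<⇒≤ n≤) (m⊔n≤o⇒n≤o (endpoint I) (maxEndpoint φ) k) s′ ⊨φ

-- The separating formula

four-to-five : Formula Unary
four-to-five = F (unbounded closed 0) (F (bounded open′ 4 5 open′) (atom zero))

module _ (K n₀ : ℕ) where
  open Words K n₀

  private
    -- In thirds, (4,5) becomes (12,15), and all distances in the word for `false` are multiples of
    -- 4.
    no-multiple : ∀ k → 12 < k * 4 → ¬ k * 4 < 15
    no-multiple k 12<4k 4k<15 =
      <⇒≱ 4k<15 (≤-trans (n≤1+n 15) (*-monoˡ-≤ 4 (*-cancelʳ-< 4 3 k 12<4k)))

  word-false⊭ : ¬ 𝓛 four-to-five (word false)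
  word-false⊭ (i , _ , _ , j , i<j , t , _) =
    let (12<d , d<15) = to (elapsed false (bounded open′ 4 5 open′) i j i<j) t
        d≡4k = sym (*-distribʳ-∣-∣ 4 (toℕ j) (toℕ i)) in
    no-multiple ∣ toℕ j - toℕ i ∣ (subst (12 <_) d≡4k 12<d) (subst (_< 15) d≡4k d<15)

  -- The events at `C` and `C + 3` enclose the long gap and two ordinary ones: 5 + 4 + 4 = 13
  -- thirds.
  word-true⊨ : 𝓛 four-to-five (word true)
  word-true⊨ =
    i , 0<i , from (elapsed true (unbounded closed 0) zero i 0<i) z≤n ,
    j , i<j , from (elapsed true (bounded open′ 4 5 open′) i j i<j)
      (≤-reflexive (sym d≡13) , subst (_< 15) (sym d≡13) (n≤1+n 14)) , refl
    where
    C≤N   = m≤m+n C C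
    -- The summand 3 in `M` keeps `C + 3` inside the word.
    C+3≤N = +-monoʳ-≤ C {3} {C} (s≤s (s≤s (s≤s z≤n)))
    i     = proj₁ (toPosition C≤N)
    j     = proj₁ (toPosition C+3≤N)
    i≡C   = proj₂ (toPosition C≤N)
    j≡C+3 = proj₂ (toPosition C+3≤N)
    0<i : 0 < toℕ i
    0<i = subst (0 <_) (sym i≡C) (s≤s z≤n)
    i<j : toℕ i < toℕ j
    i<j = subst₂ _<_ (sym i≡C) (sym j≡C+3) (m<m+n C (s≤s z≤n))
    d≡13 : dist true (toℕ j) (toℕ i) ≡ 13
    d≡13 = begin
      dist true (toℕ j) (toℕ i)                   ≡⟨ cong₂ (dist true) (trans j≡C+3 (+-comm C 3)) i≡C ⟩
      dist true (3 + C) C                         ≡⟨ cong₂ (λ x y → ∣ x + (3 + C) * 4 - y + C * 4 ∣)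
                                                       (late-after (m<n+m C {3} (s≤s z≤n))) (late-before ≤-refl) ⟩
      ∣ 13 + C * 4 - C * 4 ∣                      ≡⟨ cong (∣_- C * 4 ∣) (+-comm 13 (C * 4)) ⟩
      ∣ C * 4 + 13 - C * 4 ∣                      ≡⟨ ∣m+n-m∣≡n (C * 4) 13 ⟩
      13                                          ∎
      where
      open Relation.Binary.PropositionalEquality.≡-Reasoning
      ∣m+n-m∣≡n : ∀ m n → ∣ m + n - m ∣ ≡ n
      ∣m+n-m∣≡n m n = trans (∣-∣-comm (m + n) m) (∣m-m+n∣≡n m n)

theorem9 : (∀ (A : Alphabet) (L : TimedLanguage A) → DefinableIn MITL[F-0∞,P-0∞] L → DefinableIn MITL[F-I,P-I] L)
    × (Σ Alphabet λ A → Σ (TimedLanguage A) λ L → DefinableIn MITL[F-I,P-I] L × ¬ DefinableIn MITL[F-0∞,P-0∞] L)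
theorem9 =
  (λ A L (φ , φ∈Λ , L⇔φ) → φ , AllIntervals-map proj₁ φ φ∈Λ , L⇔φ) ,
  Unary , 𝓛 four-to-five ,
  (four-to-five , ((λ c ()) , (λ c ()) , tt) , (λ ρ → ⇔-id (𝓛 four-to-five ρ))) ,
  (λ (φ , φ∈Λ , L⇔φ) →
    -- The words are chosen after `φ`, from its endpoints and depth. Their initial positions
    -- coincide, hence are similar.
    let open Words (maxEndpoint φ) (depth φ) in
    word-false⊭ (maxEndpoint φ) (depth φ) (from (L⇔φ (word false))
      (invariant φ true false φ∈Λ ≤-refl ≤-refl ≤-refl (inj₁ refl)
        (to (L⇔φ (word true)) (word-true⊨ (maxEndpoint φ) (depth φ))))))
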